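{- Let $T$ be an $r$-row rectangular (non-skew) fluctuating tableau of length $n$. Then (a) $\mathcal P^n(T)=T$, and (b) $L(\mathcal E(T))=\varepsilon(L(T))$.
   Context: An $r$-row generalized partition is $\lambda=(\lambda_1,\ldots,\lambda_r)\in\mathbb Z^r$ with $\lambda_1\ge\cdots\ge\lambda_r$. Let $\mathcal A_r$ be the set of subsets $S\subseteq\{\pm1,\ldots,\pm r\}$ all of whose elements have the same sign (including $\emptyset$); $\mathbf e_S=\sum_{s\in S}\mathbf e_s$ if $S$ is positive and $\mathbf e_S=-\sum_{s\in S}\mathbf e_{ -s}$ if $S$ is negative ($\mathbf e_1,\dots,\mathbf e_r$ the standard basis of $\mathbb Z^r$). An $r$-row fluctuating tableau of length $n$ is a sequence $T=(\lambda^0,\ldots,\lambda^n)$ of $r$-row generalized partitions with $\lambda^k=\lambda^{k-1}+\mathbf e_{S_k}$, $S_k\in\mathcal A_r$; its lattice word is $L(T)=S_1S_2\cdots S_n$. It is non-skew if $\lambda^0=0$, and rectangular if moreover $\lambda^n_1=\cdots=\lambda^n_r$. For $\alpha\in\mathbb Z^r$, $\mathrm{sort}(\alpha)$ is its weakly decreasing rearrangement. The promotion–evacuation diagram of $T$ is $(\lambda^{i,j})_{0\le i\le n,\ i\le j\le n+i}$ with $\lambda^{0,j}=\lambda^j$, $\lambda^{i,i}=\lambda^0$, $\lambda^{i,n+i}=\lambda^n$ ($1\le i\le n$), and for $1\le i\le n$, $i<j<n+i$ (increasing $i$, then $j$), $\lambda^{i,j}=\mathrm{sort}(\lambda^{i-1,j}+\lambda^{i,j-1}-\lambda^{i-1,j-1})$.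 Promotion: $\mathcal P(T)=(\lambda^{1,1},\ldots,\lambda^{1,n+1})$; evacuation: $\mathcal E(T)=(\lambda^{n,n},\lambda^{n-1,n},\ldots,\lambda^{0,n})$. For a word $w_1\cdots w_n$ with letters in $\mathcal A_r$, $\varepsilon(w_1\cdots w_n)=\varepsilon(w_n)\cdots\varepsilon(w_1)$, where $\varepsilon(S)=\{\mathrm{sgn}(s)(r-|s|+1):s\in S\}$. -}

module Defs where

open import Data.Nat as ℕ using (ℕ; zero; suc)
open import Data.Integer as ℤ using (ℤ; 0ℤ; 1ℤ; -1ℤ; _≤_; _+_; _-_)
open import Data.Fin as Fin using (Fin; opposite; fromℕ; inject₁)
import Data.Fin.Properties as FinP
open import Data.Fin.Subset using (Subset; ⊥)
open import Data.Vec as Vec using (Vec; []; _∷_; lookup; tabulate; replicate; zipWith)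
open import Data.Bool using (Bool; true; false; if_then_else_)
open import Data.Product using (Σ; _×_; _,_; ∃)
open import Data.Sum using (_⊎_)
open import Relation.Nullary using (does)
open import Relation.Binary.PropositionalEquality using (_≡_)
open import Function using (_∘_)

ZVec : ℕ → Set
ZVec r = Vec ℤ r

_⊕_ : ∀ {r} → ZVec r → ZVec r → ZVec r
_⊕_ = zipWith _+_

_⊖_ : ∀ {r} → ZVec r → ZVec r → ZVec r
_⊖_ = zipWith _-_

IsGenPartition : ∀ {r} → ZVec r → Set
IsGenPartition {r} v = ∀ (i j : Fin r) → i Fin.≤ j → lookup v j ≤ lookup v i

insertDec : ∀ {m} → ℤ → ZVec m → ZVec (suc m)
insertDec x [] = x ∷ []
insertDec x (y ∷ ys) = if does (y ℤ.≤? x) then x ∷ y ∷ ys else y ∷ insertDec x ys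

sort : ∀ {r} → ZVec r → ZVec r
sort [] = []
sort (x ∷ xs) = insertDec x (sort xs)

-- A letter S ∈ 𝒜_r, a subset of {±1,…,±r}, is encoded by the pair
-- (positive part, negative part): index i : Fin r stands for ±(toℕ i + 1).
Letter : ℕ → Set
Letter r = Subset r × Subset r

IsLetter : ∀ {r} → Letter r → Set
IsLetter (p , q) = (p ≡ ⊥) ⊎ (q ≡ ⊥)

b2z : Bool → ℤ
b2z true = 1ℤ
b2z false = 0ℤ

eVec : ∀ {r} → Letter r → ZVec r
eVec (p , q) = tabulate λ i → b2z (lookup p i) - b2z (lookup q i)

-- the letter S with e_S = d (for d ∈ {0,1}^r ∪ {0,-1}^r)
letterOf : ∀ {r} → ZVec r → Letter r
letterOf d = tabulate (λ i → does (lookup d i ℤ.≟ 1ℤ)) , tabulate (λ i → does (lookup d i ℤ.≟ -1ℤ))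

-- ε(S) = { sgn(s) (r - |s| + 1) : s ∈ S }
εL : ∀ {r} → Letter r → Letter r
εL (p , q) = tabulate (lookup p ∘ opposite) , tabulate (lookup q ∘ opposite)

Word : ℕ → ℕ → Set
Word r n = Fin n → Letter r

εW : ∀ {r n} → Word r n → Word r n
εW w k = εL (w (opposite k))

Seq : ℕ → ℕ → Set
Seq r n = Fin (suc n) → ZVec r

IsFluctuatingTableau : ∀ {r n} → Seq r n → Set
IsFluctuatingTableau {r} {n} T =
  (∀ k → IsGenPartition (T k)) ×
  (∀ (k : Fin n) → ∃ λ (S : Letter r) → IsLetter S × (T (Fin.suc k) ≡ T (inject₁ k) ⊕ eVec S))

IsNonSkew : ∀ {r n} → Seq r n → Set
IsNonSkew T = T Fin.zero ≡ replicate _ 0ℤ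

IsRectangular : ∀ {r n} → Seq r n → Set
IsRectangular {r} {n} T =
  IsNonSkew T × (∀ (i j : Fin r) → lookup (T (fromℕ n)) i ≡ lookup (T (fromℕ n)) j)

latticeWord : ∀ {r n} → Seq r n → Word r n
latticeWord T k = letterOf (T (Fin.suc k) ⊖ T (inject₁ k))

-- λ^m for m : ℕ (values beyond n are never used)
at : ∀ {r n} → Seq r n → ℕ → ZVec r
at {n = n} T m with m ℕ.<? suc n
... | Relation.Nullary.yes p = T (Fin.fromℕ< p)
... | Relation.Nullary.no _ = T (fromℕ n)

-- promotion–evacuation diagram, indexed by offset:  PE T i m = λ^{i,i+m}, 0 ≤ m ≤ n
PE : ∀ {r n} → Seq r n → ℕ → ℕ → ZVec r
PE T zero m = at T m
PE T (suc i) zero = at T 0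
PE {n = n} T (suc i) (suc m) =
  if does (suc m ℕ.≟ n) then at T n
  else sort ((PE T i (suc (suc m)) ⊕ PE T (suc i) m) ⊖ PE T i (suc m))

promotion : ∀ {r n} → Seq r n → Seq r n
promotion T k = PE T 1 (Fin.toℕ k)

promotionIter : ∀ {r n} → ℕ → Seq r n → Seq r n
promotionIter zero T = T
promotionIter (suc k) T = promotion (promotionIter k T)

evacuation : ∀ {r n} → Seq r n → Seq r n
evacuation {n = n} T k = PE T (n ℕ.∸ Fin.toℕ k) (Fin.toℕ k)

-- Everything reduces to λ^{i,n} = c·1 - reverse(λ^{0,i}), where c·1 = λ^n: this is (b), and
-- applied first to T and then to promotions of T it gives P^n(T) = T by double complementation.
-- In the rectangle of the diagram with corners 0 (lower left), μ (upper left), c·1 (upper right)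
-- and ν (lower right) it says that μ and ν are complementary, and it suffices to show
--   k c - (sum of the k smallest entries of μ) ≤ (sum of the k largest entries of ν)   for all k,
-- because rotating the rectangle by a half turn (and negating) gives the reverse inequalities.
-- As in Greene's theorem, consider for each row of the rectangle the weakly decreasing chains
-- I_1 ≥ I_2 ≥ ... of k-subsets of the row indices and their scores Σ_j e_{S_j}(I_j). The constant
-- chain of the last k indices has the left-hand side as its score in the upper row, and in the
-- lower row, which starts at 0, no score exceeds the right-hand side. The local rule is a sequence
-- of swaps of adjacent entries, and following the subsets through these swaps turns a chain in
-- one row into a chain of at least the same score in the next row.
module Submission where

open import Defs
open import Data.Nat as ℕ using (ℕ; zero; suc)
import Data.Nat.Properties as ℕP
open import Data.Integer as ℤ using (ℤ; 0ℤ; 1ℤ; -1ℤ; _+_; _-_; -_; _≤_; _<_)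
import Data.Integer.Properties as ℤP
open import Data.Integer.Tactic.RingSolver using (solve-∀)
open import Data.Fin as Fin using (Fin; toℕ; opposite; inject≤; inject₁; fromℕ)
import Data.Fin.Properties as FinP
import Data.Fin.Permutation as Perm
import Data.Fin.Permutation.Components as PC
open import Data.Vec using (Vec; []; _∷_; lookup; tabulate)
import Data.Vec.Properties as VecP
open import Data.Bool using (true; false)
open import Data.Product using (_×_; _,_; ∃; ∃₂; proj₁; proj₂)
open import Data.Sum using (_⊎_; inj₁; inj₂)
open import Function using (_∘_)
open import Relation.Binary.Definitions using (tri<; tri≈; tri>)
open import Relation.Nullary using (does; yes; no; contradiction)
open import Relation.Nullary.Decidable using (dec-true; dec-false)
open import Relation.Binary.PropositionalEquality
open import Algebra.Properties.AbelianGroup ℤP.+-0-abelianGroup using (∙-cancelˡ)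
open import Algebra.Properties.CommutativeMonoid.Sum ℤP.+-0-commutativeMonoid
  using (sum; sum-cong-≗; sum-permute; sum-init-last)
  renaming (∑-distrib-+ to sum-+)

private variable
  r k m : ℕ

-- Integer inequalities certified by ring identities.

≤-by : ∀ {x y a b} → x ≤ y → b - a ≡ y - x → a ≤ b
≤-by {x} {y} {a} {b} x≤y eq = ℤP.0≤i-j⇒j≤i (subst (0ℤ ≤_) (sym eq) (ℤP.i≤j⇒0≤j-i x≤y))

≤-by₂ : ∀ {x y z w a b} → x ≤ y → z ≤ w → b - a ≡ (y + w) - (x + z) → a ≤ b
≤-by₂ x≤y z≤w = ≤-by (ℤP.+-mono-≤ x≤y z≤w)

≤-by₃ : ∀ {x y z w u v a b} → x ≤ y → z ≤ w → u ≤ v →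
        b - a ≡ ((y + w) + v) - ((x + z) + u) → a ≤ b
≤-by₃ x≤y z≤w = ≤-by₂ (ℤP.+-mono-≤ x≤y z≤w)

-- Dominant vectors, steps and adjacent swaps.

Dominant : (Fin r → ℤ) → Set
Dominant f = ∀ i j → i Fin.≤ j → f j ≤ f i

-- A letter e_S has all its entries in {0,1} or all in {0,-1}; only this
-- consequence is used, which makes the two signs indistinguishable.
record Step (f g : Fin r → ℤ) : Set where
  constructor mkStep
  field
    spread : ∀ i j → g i - f i ≤ 1ℤ + (g j - f j)
open Step

-- Only the set of differences matters to `Step`, which is how steps survive swaps.
Step-reindex : ∀ {f g f′ g′ : Fin r → ℤ} → (∀ i → ∃ λ i′ → g′ i - f′ i ≡ g i′ - f i′) →
               Step f g → Step f′ g′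
Step-reindex e st = mkStep λ i j →
  let i′ , p = e i
      j′ , q = e j
  in subst₂ (λ x y → x ≤ 1ℤ + y) (sym p) (sym q) (spread st i′ j′)

record Swapped (s t : Fin r) (f g : Fin r → ℤ) : Set where
  constructor swapped
  field
    atˡ   : g s ≡ f t
    atʳ   : g t ≡ f s
    other : ∀ i → i ≢ s → i ≢ t → g i ≡ f i

_⇝₁_ : (f g : Fin r → ℤ) → Set
f ⇝₁ g = ∃₂ λ s t → toℕ t ≡ suc (toℕ s) × f t < f s × Swapped s t f g

infix 4 _⇝₁_ _⇝_

-- Each swap turns a strict descent into an ascent; read backwards this is bubble sort. `done` takes
-- pointwise equality in place of function extensionality.
data _⇝_ {r} (f g : Fin r → ℤ) : Set where
  done : f ≗ g → f ⇝ g
  step : ∀ {h} → f ⇝₁ h → h ⇝ g → f ⇝ g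

⇝₁-respˡ : ∀ {f f′ g : Fin r → ℤ} → f ≗ f′ → f ⇝₁ g → f′ ⇝₁ g
⇝₁-respˡ e (s , t , adj , lt , swapped a b c) =
  s , t , adj , subst₂ _<_ (e t) (e s) lt ,
  swapped (trans a (e t)) (trans b (e s)) (λ i p q → trans (c i p q) (e i))

⇝-respˡ : ∀ {f f′ g : Fin r → ℤ} → f ≗ f′ → f ⇝ g → f′ ⇝ g
⇝-respˡ e (done p)   = done (λ i → trans (sym (e i)) (p i))
⇝-respˡ e (step x p) = step (⇝₁-respˡ e x) p

⇝-trans : ∀ {f g h : Fin r → ℤ} → f ⇝ g → g ⇝ h → f ⇝ h
⇝-trans (done p)   q = ⇝-respˡ (λ i → sym (p i)) q
⇝-trans (step x p) q = step x (⇝-trans p q)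

⇝-respʳ : ∀ {f g g′ : Fin r → ℤ} → g ≗ g′ → f ⇝ g → f ⇝ g′
⇝-respʳ e p = ⇝-trans p (done e)

-- The half turn on one vector: negation and reversal both reverse order, so together they keep
-- dominance and descents.
rev⁻ : (Fin r → ℤ) → Fin r → ℤ
rev⁻ f i = - f (opposite i)

opposite-antitone : ∀ {i j : Fin r} → i Fin.≤ j → opposite j Fin.≤ opposite i
opposite-antitone {r} {i} {j} i≤j =
  subst₂ ℕ._≤_ (sym (FinP.opposite-prop j)) (sym (FinP.opposite-prop i))
    (ℕP.∸-monoʳ-≤ r (ℕ.s≤s i≤j))

opposite-adjacent : ∀ {s t : Fin r} → toℕ t ≡ suc (toℕ s) →
                    toℕ (opposite s) ≡ suc (toℕ (opposite t))
opposite-adjacent {r} {s} {t} adj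
  rewrite FinP.opposite-prop s | FinP.opposite-prop t | adj
  = ℕP.+-∸-assoc 1 (subst (ℕ._< r) adj (FinP.toℕ<n t))

rev⁻-dominant : ∀ {f : Fin r → ℤ} → Dominant f → Dominant (rev⁻ f)
rev⁻-dominant d i j i≤j = ℤP.neg-mono-≤ (d _ _ (opposite-antitone i≤j))

opposite-flip : ∀ {i j : Fin r} → i ≢ opposite j → opposite i ≢ j
opposite-flip i≢ refl = i≢ (sym (FinP.opposite-involutive _))

rev⁻-⇝ : ∀ {f g : Fin r → ℤ} → f ⇝ g → rev⁻ f ⇝ rev⁻ g
rev⁻-⇝ (done p) = done (λ i → cong -_ (p (opposite i)))
rev⁻-⇝ {f = f} (step {h} (s , t , adj , lt , swapped a b c) p) =
  step (opposite t , opposite s , opposite-adjacent {s = s} {t} adj ,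
        subst₂ _<_ (sym (inv f s)) (sym (inv f t)) (ℤP.neg-mono-< lt) ,
        swapped (trans (inv h t) (trans (cong -_ b) (sym (inv f s))))
                (trans (inv h s) (trans (cong -_ a) (sym (inv f t))))
                (λ i p q → cong -_ (c (opposite i) (opposite-flip q) (opposite-flip p))))
       (rev⁻-⇝ p)
  where
  inv : ∀ (f : Fin _ → ℤ) i → rev⁻ f (opposite i) ≡ - f i
  inv f i = cong (-_ ∘ f) (FinP.opposite-involutive i)

-- Subsets of the row indices and their totals.

-- A k-subset of Fin r, listed increasingly.
record Tokens (k r : ℕ) : Set where
  constructor tokens
  field
    pos  : Fin k → Fin r
    mono : ∀ p q → p Fin.< q → pos p Fin.< pos q
open Tokens

_≼_ : Tokens k r → Tokens k r → Set
J ≼ I = ∀ p → pos J p Fin.≤ pos I p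

total : (Fin r → ℤ) → Tokens k r → ℤ
total f J = sum (f ∘ pos J)

sum-mono : ∀ {n} {f g : Fin n → ℤ} → (∀ p → f p ≤ g p) → sum f ≤ sum g
sum-mono {zero}  h = ℤP.≤-refl
sum-mono {suc n} h = ℤP.+-mono-≤ (h Fin.zero) (sum-mono (h ∘ Fin.suc))

sum-neg : ∀ {n} (f : Fin n → ℤ) → sum (-_ ∘ f) ≡ - sum f
sum-neg {zero}  f = refl
sum-neg {suc n} f = trans (cong (- f Fin.zero +_) (sum-neg (f ∘ Fin.suc)))
                          (sym (ℤP.neg-distrib-+ (f Fin.zero) _))

total-antitone : ∀ {f : Fin r → ℤ} → Dominant f → {J I : Tokens k r} → J ≼ I → total f I ≤ total f J
total-antitone d J≼I = sum-mono (λ p → d _ _ (J≼I p))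

minPos : Fin r → Fin r → Fin r
minPos i j with i FinP.≤? j
... | yes _ = i
... | no  _ = j

minPos-≤ˡ : ∀ (i j : Fin r) → minPos i j Fin.≤ i
minPos-≤ˡ i j with i FinP.≤? j
... | yes _ = ℕP.≤-refl
... | no i≰j = ℕP.<⇒≤ (ℕP.≰⇒> i≰j)

minPos-≤ʳ : ∀ (i j : Fin r) → minPos i j Fin.≤ j
minPos-≤ʳ i j with i FinP.≤? j
... | yes i≤j = i≤j
... | no _ = ℕP.≤-refl

minPos-sel : ∀ (i j : Fin r) → minPos i j ≡ i ⊎ minPos i j ≡ j
minPos-sel i j with i FinP.≤? j
... | yes _ = inj₁ refl
... | no  _ = inj₂ refl

meet : Tokens k r → Tokens k r → Tokens k r
meet J I = tokens (λ p → minPos (pos J p) (pos I p)) mono′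
  where
  mono′ : ∀ p q → p Fin.< q → minPos (pos J p) (pos I p) Fin.< minPos (pos J q) (pos I q)
  mono′ p q p<q with minPos-sel (pos J q) (pos I q)
  ... | inj₁ e rewrite e = ℕP.≤-<-trans (minPos-≤ˡ (pos J p) (pos I p)) (mono J p q p<q)
  ... | inj₂ e rewrite e = ℕP.≤-<-trans (minPos-≤ʳ (pos J p) (pos I p)) (mono I p q p<q)

-- At each `p` the meet takes one of the positions of `J` and `I′`; the other lies at or before that
-- of `I`, where a dominant `f` is at least as large.
total-meet : ∀ {f : Fin r → ℤ} → Dominant f → (J I I′ : Tokens k r) → J ≼ I → I′ ≼ I →
             total f (meet J I′) + total f I ≤ total f J + total f I′
total-meet {f = f} d J I I′ J≼I I′≼I =
  subst₂ _≤_ (sum-+ (f ∘ pos (meet J I′)) (f ∘ pos I)) (sum-+ (f ∘ pos J) (f ∘ pos I′))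
    (sum-mono termwise)
  where
  termwise : ∀ p → f (minPos (pos J p) (pos I′ p)) + f (pos I p) ≤ f (pos J p) + f (pos I′ p)
  termwise p with minPos-sel (pos J p) (pos I′ p)
  ... | inj₁ e rewrite e = ℤP.+-monoʳ-≤ (f (pos J p)) (d _ _ (I′≼I p))
  ... | inj₂ e rewrite e | ℤP.+-comm (f (pos J p)) (f (pos I′ p)) =
    ℤP.+-monoʳ-≤ (f (pos I′ p)) (d _ _ (J≼I p))

pos-injective : ∀ (J : Tokens k r) {p q} → pos J p ≡ pos J q → p ≡ q
pos-injective J {p} {q} e with FinP.<-cmp p q
... | tri< a _ _ = contradiction e (FinP.<⇒≢ (mono J p q a))
... | tri≈ _ b _ = b
... | tri> _ _ c = contradiction (sym e) (FinP.<⇒≢ (mono J q p c))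

-- A token at `t` follows its value to `s` if `s` is free. If both places are occupied, the summands
-- are permuted; if `t` is free, nothing moves and a token at `s` now sees the smaller value.
slide₁ : ∀ {f g : Fin r → ℤ} → f ⇝₁ g → (J : Tokens k r) → ∃ λ J′ → J′ ≼ J × total g J′ ≤ total f J
slide₁ {r} {k} {f} {g} (s , t , adj , lt , swapped a b c) J
  with FinP.any? (λ p → pos J p Fin.≟ t) | FinP.any? (λ p → pos J p Fin.≟ s)
... | no t∉ | _ = J , (λ _ → ℕP.≤-refl) , sum-mono termwise
  where
  termwise : ∀ q → g (pos J q) ≤ f (pos J q)
  termwise q with pos J q Fin.≟ s
  ... | yes e rewrite e | a = ℤP.<⇒≤ lt
  ... | no ≢s = ℤP.≤-reflexive (c _ ≢s (λ e → t∉ (q , e)))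
... | yes (p , p↦t) | yes (p′ , p′↦s) =
  J , (λ _ → ℕP.≤-refl) ,
  ℤP.≤-reflexive (trans (sum-cong-≗ termwise) (sym (sum-permute (f ∘ pos J) (Perm.transpose p p′))))
  where
  termwise : ∀ q → g (pos J q) ≡ f (pos J (PC.transpose p p′ q))
  termwise q with q Fin.≟ p
  ... | yes refl rewrite p↦t | p′↦s = b
  ... | no q≢p with q Fin.≟ p′
  ...   | yes refl rewrite p↦t | p′↦s = a
  ...   | no q≢p′ = c _ (λ e → q≢p′ (pos-injective J (trans e (sym p′↦s))))
                        (λ e → q≢p (pos-injective J (trans e (sym p↦t))))
... | yes (p , p↦t) | no s∉ =
  tokens pos′ mono′ , below , ℤP.≤-reflexive (sum-cong-≗ termwise)
  where
  pos′ : Fin k → Fin r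
  pos′ q with q Fin.≟ p
  ... | yes _ = s
  ... | no  _ = pos J q

  below : ∀ q → pos′ q Fin.≤ pos J q
  below q with q Fin.≟ p
  ... | yes refl rewrite p↦t | adj = ℕP.n≤1+n _
  ... | no  _ = ℕP.≤-refl

  mono′ : ∀ q q′ → q Fin.< q′ → pos′ q Fin.< pos′ q′
  mono′ q q′ q<q′ with q′ Fin.≟ p
  ... | no _ = ℕP.≤-<-trans (below q) (mono J q q′ q<q′)
  ... | yes refl with q Fin.≟ q′
  ...   | yes refl = contradiction q<q′ (ℕP.<-irrefl refl)
  -- An earlier token lies before `t`, hence at or before `s` by adjacency, and `s` is free.
  ...   | no _ = ℕP.≤∧≢⇒<
      (ℕP.≤-pred (subst (suc (toℕ (pos J q)) ℕ.≤_) (trans (cong toℕ p↦t) adj) (mono J q q′ q<q′)))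
      (λ e → s∉ (q , FinP.toℕ-injective e))

  termwise : ∀ q → g (pos′ q) ≡ f (pos J q)
  termwise q with q Fin.≟ p
  ... | yes refl rewrite p↦t = a
  ... | no q≢p = c _ (λ e → s∉ (q , e)) (λ e → q≢p (pos-injective J (trans e (sym p↦t))))

slide : ∀ {f g : Fin r → ℤ} → f ⇝ g → (J : Tokens k r) → ∃ λ J′ → J′ ≼ J × total g J′ ≤ total f J
slide (done p) J = J , (λ _ → ℕP.≤-refl) , ℤP.≤-reflexive (sum-cong-≗ (λ q → sym (p (pos J q))))
slide (step x p) J =
  let J₁ , J₁≼J , le₁ = slide₁ x J
      J₂ , J₂≼J₁ , le₂ = slide p J₁
  in J₂ , (λ q → ℕP.≤-trans (J₂≼J₁ q) (J₁≼J q)) , ℤP.≤-trans le₂ le₁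

-- Transport of chains from one row to the next.

-- The lower left, upper left, lower right and upper right corners of a unit
-- square of the diagram, κ → α → ω and κ → β → ω being its two boundary paths.
record Cell (κ α β ω : Fin r → ℤ) : Set where
  constructor cell
  field
    forth : α ⇝ (λ i → κ i + ω i - β i)
    back  : β ⇝ (λ i → κ i + ω i - α i)
open Cell

Row : ℕ → Set
Row r = ℕ → Fin r → ℤ

record Promotes (A B : Row r) (m : ℕ) : Set where
  field
    domˡ  : ∀ q → q ℕ.≤ m → Dominant (A q)
    domʳ  : ∀ q → q ℕ.≤ m → Dominant (B q)
    cells : ∀ q → q ℕ.< m → Cell (B q) (A q) (B (suc q)) (A (suc q))
open Promotes

-- In Chain A m J s the tokens move to smaller and smaller indices while reading the first m
-- steps of A, and end at J; s is the sum of the step entries at the tokens.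
data Chain {k r} (A : Row r) : ℕ → Tokens k r → ℤ → Set where
  start : ∀ J → Chain A 0 J 0ℤ
  move  : ∀ {m I s} → Chain A m I s → (J : Tokens k r) → J ≼ I →
          Chain A (suc m) J (s + (total (A (suc m)) J - total (A m) J))

total-cell : ∀ (κ ω β : Fin r → ℤ) (J : Tokens k r) →
             total (λ i → κ i + ω i - β i) J ≡ total κ J + total ω J - total β J
total-cell κ ω β J =
  trans (sum-+ (λ p → κ (pos J p) + ω (pos J p)) (-_ ∘ β ∘ pos J))
        (cong₂ _+_ (sum-+ (κ ∘ pos J) (ω ∘ pos J)) (sum-neg (β ∘ pos J)))

-- The invariant strengthens `s ≤ s′`: the score grows by at least what `A m` gains from `I` to `J`.
-- Its inductive step adds the old invariant, the inequality for the meet and the one for the slide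
-- through `forth`.
transport : ∀ {A B : Row r} {m s} {I : Tokens k r} → Promotes A B m → Chain A m I s →
            ∃₂ λ J s′ → J ≼ I × Chain B m J s′ × s + total (A m) J ≤ s′ + total (A m) I
transport pr (start J) = J , 0ℤ , (λ _ → ℕP.≤-refl) , start J , ℤP.≤-refl
transport {A = A} {B} {suc m} pr (move {I = I} {s} ch I′ I′≼I) =
  let J , s′ , J≼I , ch′ , inv = transport pr⁻ ch
      -- Below `J`, so that the slid subset is a legal next move, and below `I′`, so that the new
      -- chain stays below the old one.
      M = meet J I′
      J′ , J′≼M , le = slide (forth (cells pr m ℕP.≤-refl)) M
  in J′ , _ , (λ p → ℕP.≤-trans (J′≼M p) (minPos-≤ʳ (pos J p) (pos I′ p))) ,
     move ch′ J′ (λ p → ℕP.≤-trans (J′≼M p) (minPos-≤ˡ (pos J p) (pos I′ p))) ,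
     ≤-by₃ inv (total-meet (domˡ pr m (ℕP.n≤1+n m)) J I I′ J≼I I′≼I)
       (subst (_≤ total (A m) M) (total-cell (B m) (A (suc m)) (B (suc m)) J′) le)
       (balance s s′ (total (A m) I) (total (A m) I′) (total (A m) J) (total (A m) M)
          (total (A (suc m)) I′) (total (A (suc m)) J′) (total (B m) J′) (total (B (suc m)) J′))
  where
  pr⁻ : Promotes A B m
  pr⁻ = record { domˡ = λ q q≤ → domˡ pr q (ℕP.m≤n⇒m≤1+n q≤)
               ; domʳ = λ q q≤ → domʳ pr q (ℕP.m≤n⇒m≤1+n q≤)
               ; cells = λ q q< → cells pr q (ℕP.m≤n⇒m≤1+n q<) }

  balance : ∀ s s′ αI αI′ αJ αM ωI′ ωJ′ κJ′ βJ′ →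
    ((s′ + (βJ′ - κJ′)) + ωI′) - ((s + (ωI′ - αI′)) + ωJ′) ≡
    (((s′ + αI) + (αJ + αI′)) + αM) - (((s + αJ) + (αM + αI)) + (κJ′ + ωJ′ - βJ′))
  balance = solve-∀

Transports : Row r → Row r → ℕ → Set
Transports {r} A B m = ∀ {k} {I : Tokens k r} {s} → Chain A m I s →
                       ∃₂ λ (J : Tokens k r) s′ → s ≤ s′ × Chain B m J s′

promotes⇒transports : ∀ {A B : Row r} → Promotes A B m → Transports A B m
promotes⇒transports {m = m} {A} pr {I = I} {s} ch =
  let J , s′ , J≼I , ch′ , inv = transport pr ch
  in J , s′ , ≤-by₂ inv (total-antitone (domˡ pr m ℕP.≤-refl) {J} {I} J≼I)
                (cancel s s′ (total (A m) I) (total (A m) J)) , ch′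
  where
  cancel : ∀ s s′ x y → s′ - s ≡ ((s′ + x) + y) - ((s + y) + x)
  cancel = solve-∀

transports-refl : ∀ {A : Row r} → Transports A A m
transports-refl ch = _ , _ , ℤP.≤-refl , ch

transports-trans : ∀ {A B C : Row r} → Transports A B m → Transports B C m → Transports A C m
transports-trans f g ch =
  let _ , _ , le , ch′ = f ch
      _ , _ , le′ , ch″ = g ch′
  in _ , _ , ℤP.≤-trans le le′ , ch″

-- The half turn of a rectangle.

rotate : ℕ → Row r → Row r
rotate m A q = rev⁻ (A (m ℕ.∸ q))

-- Opposite corners of each cell are exchanged, so `forth` and `back` trade places.
promotes-rotate : ∀ {A B : Row r} → Promotes A B m → Promotes (rotate m B) (rotate m A) m
promotes-rotate {m = m} {A} {B} pr = record
  { domˡ  = λ q _ → rev⁻-dominant (domʳ pr (m ℕ.∸ q) (ℕP.m∸n≤m m q))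
  ; domʳ  = λ q _ → rev⁻-dominant (domˡ pr (m ℕ.∸ q) (ℕP.m∸n≤m m q))
  ; cells = λ q q<m → rotated q q<m }
  where
  neg-cell : ∀ κ ω β → - (κ + ω - β) ≡ - ω + - κ - - β
  neg-cell = solve-∀

  rotated : ∀ q → q ℕ.< m → Cell (rotate m A q) (rotate m B q) (rotate m A (suc q)) (rotate m B (suc q))
  rotated q q<m rewrite ℕP.+-∸-assoc 1 q<m =
    cell (⇝-respʳ (λ i → neg-cell (B q′ (opposite i)) (A (suc q′) (opposite i)) (A q′ (opposite i))) (rev⁻-⇝ (back c)))
         (⇝-respʳ (λ i → neg-cell (B q′ (opposite i)) (A (suc q′) (opposite i)) (B (suc q′) (opposite i))) (rev⁻-⇝ (forth c)))
    where
    q′ = m ℕ.∸ suc q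
    c = cells pr q′ (ℕP.∸-monoʳ-< {m} {suc q} {0} (ℕ.s≤s ℕ.z≤n) q<m)

-- Bounds on scores and complementary corners.

constant-chain : ∀ (A : Row r) m (K : Tokens k r) →
                 ∃ λ s → s ≡ total (A m) K - total (A 0) K × Chain A m K s
constant-chain A zero K = 0ℤ , sym (ℤP.+-inverseʳ (total (A 0) K)) , start K
constant-chain A (suc m) K =
  let s , eq , ch = constant-chain A m K
  in _ , trans (cong (_+ (total (A (suc m)) K - total (A m) K)) eq)
               (telescope (total (A m) K) (total (A 0) K) (total (A (suc m)) K)) ,
     move ch K (λ _ → ℕP.≤-refl)
  where
  telescope : ∀ x y z → (x - y) + (z - x) ≡ z - y
  telescope = solve-∀

-- Moving to smaller indices can only raise the total of a dominant vector, so each move raises the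
-- total by at least its score.
chain-bound : ∀ {B : Row r} {m s l} {J : Tokens k r} → (∀ q → q ℕ.≤ m → Dominant (B q)) →
              (∀ (I : Tokens k r) → l ≤ total (B 0) I) → Chain B m J s → s + l ≤ total (B m) J
chain-bound {l = l} d lo (start J) = subst (_≤ _) (sym (ℤP.+-identityˡ l)) (lo J)
chain-bound {B = B} {l = l} d lo (move {m} {I} {s} ch J J≼I) =
  ≤-by₂ (chain-bound (λ q q≤ → d q (ℕP.m≤n⇒m≤1+n q≤)) lo ch)
        (total-antitone (d m (ℕP.n≤1+n m)) {J} {I} J≼I)
        (regroup s l (total (B m) I) (total (B m) J) (total (B (suc m)) J))
  where
  regroup : ∀ s l x y z → z - ((s + (z - y)) + l) ≡ (x + y) - ((s + l) + x)
  regroup = solve-∀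

-- In a dominant vector these indices carry the k largest entries.
leading : .(k ℕ.≤ r) → Tokens k r
leading k≤r = tokens (λ p → inject≤ p k≤r) λ p q p<q →
  subst₂ ℕ._<_ (sym (FinP.toℕ-inject≤ p k≤r)) (sym (FinP.toℕ-inject≤ q k≤r)) p<q

opposite-strict : ∀ {i j : Fin r} → i Fin.< j → opposite j Fin.< opposite i
opposite-strict {i = i} {j} i<j = ℕP.≤∧≢⇒< (opposite-antitone (ℕP.<⇒≤ i<j)) λ e →
  FinP.<⇒≢ i<j (sym (trans (sym (FinP.opposite-involutive j))
    (trans (cong opposite (FinP.toℕ-injective e)) (FinP.opposite-involutive i))))

trailing : .(k ℕ.≤ r) → Tokens k r
trailing k≤r = tokens (opposite ∘ pos (leading k≤r) ∘ opposite) λ p q p<q →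
  opposite-strict (mono (leading k≤r) (opposite q) (opposite p) (opposite-strict p<q))

pos-lower : ∀ (J : Tokens k r) p → toℕ p ℕ.≤ toℕ (pos J p)
pos-lower J p = go (toℕ p) p refl
  where
  go : ∀ n p → toℕ p ≡ n → n ℕ.≤ toℕ (pos J p)
  go zero    p e = ℕ.z≤n
  go (suc n) (Fin.suc p) e =
    ℕP.≤-<-trans (go n (inject₁ p) (trans (FinP.toℕ-inject₁ p) (ℕP.suc-injective e)))
      (mono J (inject₁ p) (Fin.suc p) (ℕ.s≤s (ℕP.≤-reflexive (FinP.toℕ-inject₁ p))))

total-≤-leading : ∀ {f : Fin r → ℤ} → Dominant f → .(k≤r : k ℕ.≤ r) (J : Tokens k r) →
                  total f J ≤ total f (leading k≤r)
total-≤-leading d k≤r J = sum-mono λ p → d _ _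
  (subst (ℕ._≤ _) (sym (FinP.toℕ-inject≤ p k≤r)) (pos-lower J p))

-- The constant chain at `K` in the upper row is transported to the lower one. `B 0` may be any
-- constant vector, because after the half turn the lower row starts at `- c`.
rectangle-bound : ∀ {A B : Row r} → Transports A B m → (∀ q → q ℕ.≤ m → Dominant (B q)) →
  (∀ i j → B 0 i ≡ B 0 j) → .(k≤r : k ℕ.≤ r) (K : Tokens k r) →
  total (λ i → A m i + B 0 i - A 0 i) K ≤ total (B m) (leading k≤r)
rectangle-bound {m = m} {k = k} {A = A} {B} tr d const k≤r K =
  let s , eq , ch = constant-chain A m K
      J , s′ , s≤s′ , ch′ = tr ch
      bound = chain-bound {l = total (B 0) K} d
        (λ I → ℤP.≤-reflexive (sum-cong-≗ {k} (λ p → const (pos K p) (pos I p)))) ch′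
  in ℤP.≤-trans
       (≤-by (subst (_≤ s′) eq s≤s′)
         (trans (cong (λ x → (s′ + total (B 0) K) - x) (total-cell (A m) (B 0) (A 0) K))
                (regroup s′ (total (A m) K) (total (A 0) K) (total (B 0) K))))
       (ℤP.≤-trans bound (total-≤-leading (d m ℕP.≤-refl) k≤r J))
  where
  regroup : ∀ s x y z → (s + z) - (x + z - y) ≡ s - (x - y)
  regroup = solve-∀

total-reverse : ∀ (f : Fin r → ℤ) .(k≤r : k ℕ.≤ r) →
                total f (leading k≤r) ≡ sum (f ∘ pos (leading k≤r) ∘ opposite)
total-reverse f k≤r = sum-permute (f ∘ pos (leading k≤r)) Perm.reverse

-- Each entry is the difference of two consecutive prefix totals.
leading-totals-determine : ∀ {f g : Fin r → ℤ} →
  (∀ k → .(k≤r : k ℕ.≤ r) → total f (leading k≤r) ≡ total g (leading k≤r)) → f ≗ g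
leading-totals-determine {r} {f} {g} h i =
  subst (λ j → f j ≡ g j) last≡i
    (∙-cancelˡ (total f (leading n≤r)) _ _
      (trans (sym (split f)) (trans (h (suc n) (FinP.toℕ<n i)) (trans (split g) (cong (_+ g last) (sym (h n n≤r)))))))
  where
  n = toℕ i
  n≤r : n ℕ.≤ r
  n≤r = ℕP.<⇒≤ (FinP.toℕ<n i)
  last : Fin r
  last = inject≤ (fromℕ n) (FinP.toℕ<n i)
  last≡i : last ≡ i
  last≡i = FinP.toℕ-injective (trans (FinP.toℕ-inject≤ (fromℕ n) (FinP.toℕ<n i)) (FinP.toℕ-fromℕ n))
  split : ∀ (f : Fin r → ℤ) →
    total f (leading (FinP.toℕ<n i)) ≡ total f (leading n≤r) + f last
  split f = trans (sum-init-last (f ∘ pos (leading (FinP.toℕ<n i))))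
    (cong (_+ f last) (sum-cong-≗ {n} λ p → cong f (FinP.toℕ-injective
      (trans (FinP.toℕ-inject≤ (inject₁ p) _) (trans (FinP.toℕ-inject₁ p) (sym (FinP.toℕ-inject≤ p _)))))))

rectangle-complement : ∀ {A B : Row r} {c} →
  Transports A B m → Transports (rotate m B) (rotate m A) m →
  (∀ q → q ℕ.≤ m → Dominant (A q)) → (∀ q → q ℕ.≤ m → Dominant (B q)) →
  (∀ i → A m i ≡ c) → (∀ i → B 0 i ≡ 0ℤ) →
  ∀ i → B m i ≡ c - A 0 (opposite i)
rectangle-complement {r} {m} {A} {B} {c} tr tr′ dA dB Am B0 =
  leading-totals-determine λ k k≤r → ℤP.≤-antisym (upper k≤r) (lower k≤r)
  where
  h : Fin r → ℤ
  h i = c - A 0 (opposite i)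

  lower : ∀ {k} → .(k≤r : k ℕ.≤ r) → total h (leading k≤r) ≤ total (B m) (leading k≤r)
  lower k≤r = subst (_≤ total (B m) (leading k≤r))
    (trans (sum-cong-≗ λ p → trans (cong₂ (λ x y → x + y - A 0 (pos (trailing k≤r) p)) (Am _) (B0 _))
                                   (cong (_- A 0 (pos (trailing k≤r) p)) (ℤP.+-identityʳ c)))
           (sym (total-reverse h k≤r)))
    (rectangle-bound tr dB (λ i j → trans (B0 i) (sym (B0 j))) k≤r (trailing k≤r))

  A′0 : ∀ i → rotate m A 0 i ≡ - c
  A′0 i = cong -_ (Am (opposite i))

  B′m : ∀ i → rotate m B m i ≡ 0ℤ
  B′m i rewrite ℕP.n∸n≡0 m = cong -_ (B0 (opposite i))

  A′m : ∀ i → rotate m A m i ≡ - A 0 (opposite i)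
  A′m i rewrite ℕP.n∸n≡0 m = refl

  dominant : ∀ q → q ℕ.≤ m → Dominant (rotate m A q)
  dominant q _ = rev⁻-dominant (dA (m ℕ.∸ q) (ℕP.m∸n≤m m q))

  shift : ∀ c x → 0ℤ + - c - - x ≡ x - c
  shift = solve-∀

  unshift : ∀ c x → x ≡ c + (x - c)
  unshift = solve-∀

  -- In the rotated rectangle the upper row ends at 0 and the lower one starts at `- c`; `upper`
  -- adds `c` back for each of the `k` indices.
  bound : ∀ {k} → .(k≤r : k ℕ.≤ r) →
          total (λ i → B m i - c) (leading k≤r) ≤ total (λ i → - A 0 (opposite i)) (leading k≤r)
  bound k≤r = subst₂ _≤_
    (trans (sum-cong-≗ λ p →
              trans (cong₂ (λ x y → x + y - rotate m B 0 (pos (trailing k≤r) p)) (B′m _) (A′0 _))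
             (trans (shift c _)
                    (cong (λ i → B m i - c) (FinP.opposite-involutive (pos (leading k≤r) (opposite p))))))
           (sym (total-reverse (λ i → B m i - c) k≤r)))
    (sum-cong-≗ λ p → A′m (pos (leading k≤r) p))
    (rectangle-bound tr′ dominant (λ i j → trans (A′0 i) (sym (A′0 j))) k≤r (trailing k≤r))

  upper : ∀ {k} → .(k≤r : k ℕ.≤ r) → total (B m) (leading k≤r) ≤ total h (leading k≤r)
  upper {k} k≤r = subst₂ _≤_
    (trans (sym (sum-+ (λ _ → c) (λ p → B m (pos (leading k≤r) p) - c)))
           (sum-cong-≗ λ p → sym (unshift c (B m (pos (leading k≤r) p)))))
    (sym (sum-+ (λ _ → c) (λ p → - A 0 (opposite (pos (leading k≤r) p)))))
    (ℤP.+-monoʳ-≤ (sum {k} λ _ → c) (bound k≤r))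

-- Insertion sort as adjacent swaps.

lift-⇝ : ∀ {f g : Fin r → ℤ} → f ⇝ g → (F G : Fin (suc r) → ℤ) →
         F Fin.zero ≡ G Fin.zero → F ∘ Fin.suc ≗ f → G ∘ Fin.suc ≗ g → F ⇝ G
lift-⇝ (done p) F G e eF eG = done λ
  { Fin.zero → e ; (Fin.suc i) → trans (eF i) (trans (p i) (sym (eG i))) }
lift-⇝ {r} (step {h} (s , t , adj , lt , swapped a b c) p) F G e eF eG =
  step {h = H} (Fin.suc s , Fin.suc t , cong suc adj ,
        subst₂ _<_ (sym (eF t)) (sym (eF s)) lt ,
        swapped (trans a (sym (eF t))) (trans b (sym (eF s))) others)
       (lift-⇝ p H G e (λ _ → refl) eG)
  where
  H : Fin (suc r) → ℤ
  H Fin.zero    = F Fin.zero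
  H (Fin.suc i) = h i
  others : ∀ i → i ≢ Fin.suc s → i ≢ Fin.suc t → H i ≡ F i
  others Fin.zero    _ _ = refl
  others (Fin.suc i) p q = trans (c i (p ∘ cong Fin.suc) (q ∘ cong Fin.suc)) (sym (eF i))

-- Insertion is undone by carrying `x` to the front: every entry it crosses is strictly larger, so
-- every swap starts from a descent.
insertDec-⇝ : ∀ x (v : ZVec r) → lookup (insertDec x v) ⇝ lookup (x ∷ v)
insertDec-⇝ x [] = done λ _ → refl
insertDec-⇝ x (y ∷ v) with y ℤ.≤? x
... | yes _ = done λ _ → refl
... | no y≰x =
  ⇝-trans
    (lift-⇝ (insertDec-⇝ x v) _ (lookup (y ∷ x ∷ v)) refl (λ _ → refl) (λ _ → refl))
    (step (Fin.zero , Fin.suc Fin.zero , refl , ℤP.≰⇒> y≰x , swapped refl refl others) (done λ _ → refl))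
  where
  others : ∀ i → i ≢ Fin.zero → i ≢ Fin.suc Fin.zero → lookup (x ∷ y ∷ v) i ≡ lookup (y ∷ x ∷ v) i
  others Fin.zero p _ = contradiction refl p
  others (Fin.suc Fin.zero) _ q = contradiction refl q
  others (Fin.suc (Fin.suc i)) _ _ = refl

sort-⇝ : ∀ (v : ZVec r) → lookup (sort v) ⇝ lookup v
sort-⇝ [] = done λ _ → refl
sort-⇝ (x ∷ v) = ⇝-trans (insertDec-⇝ x (sort v))
  (lift-⇝ (sort-⇝ v) _ _ refl (λ _ → refl) (λ _ → refl))

insertDec-≤ : ∀ {b} x (v : ZVec r) → x ≤ b → (∀ i → lookup v i ≤ b) → ∀ i → lookup (insertDec x v) i ≤ b
insertDec-≤ x [] x≤ v≤ Fin.zero = x≤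
insertDec-≤ x (y ∷ v) x≤ v≤ i with y ℤ.≤? x | i
... | yes _ | Fin.zero = x≤
... | yes _ | Fin.suc j = v≤ j
... | no _ | Fin.zero = v≤ Fin.zero
... | no _ | Fin.suc j = insertDec-≤ x v x≤ (v≤ ∘ Fin.suc) j

∷-dominant : ∀ {x} {v : ZVec r} → (∀ i → lookup v i ≤ x) → Dominant (lookup v) → Dominant (lookup (x ∷ v))
∷-dominant v≤ d Fin.zero Fin.zero _ = ℤP.≤-refl
∷-dominant v≤ d Fin.zero (Fin.suc j) _ = v≤ j
∷-dominant v≤ d (Fin.suc i) (Fin.suc j) (ℕ.s≤s i≤j) = d i j i≤j

insertDec-dominant : ∀ x (v : ZVec r) → Dominant (lookup v) → Dominant (lookup (insertDec x v))
insertDec-dominant x [] d = ∷-dominant (λ ()) d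
insertDec-dominant x (y ∷ v) d with y ℤ.≤? x
... | yes y≤x = ∷-dominant (λ i → ℤP.≤-trans (d Fin.zero i ℕ.z≤n) y≤x) d
... | no y≰x = ∷-dominant
  (insertDec-≤ x v (ℤP.<⇒≤ (ℤP.≰⇒> y≰x)) (λ i → d Fin.zero (Fin.suc i) ℕ.z≤n))
  (insertDec-dominant x v (λ i j i≤j → d (Fin.suc i) (Fin.suc j) (ℕ.s≤s i≤j)))

sort-dominant : ∀ (v : ZVec r) → Dominant (lookup (sort v))
sort-dominant [] ()
sort-dominant (x ∷ v) = insertDec-dominant x (sort v) (sort-dominant v)

-- The local rule produces cells.

swap-reindex : ∀ {s t : Fin r} {f g f′ g′ : Fin r → ℤ} → Swapped s t f f′ → Swapped s t g g′ →
               ∀ i → ∃ λ i′ → g i - f i ≡ g′ i′ - f′ i′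
swap-reindex {s = s} {t} (swapped a b c) (swapped a′ b′ c′) i with i Fin.≟ s
... | yes refl = t , cong₂ _-_ (sym b′) (sym b)
... | no i≢s with i Fin.≟ t
...   | yes refl = s , cong₂ _-_ (sym a′) (sym a)
...   | no i≢t = i , cong₂ _-_ (sym (c′ i i≢s i≢t)) (sym (c i i≢s i≢t))

swapped-const : ∀ {s t : Fin r} {f : Fin r → ℤ} → f s ≡ f t → Swapped s t f f
swapped-const e = swapped e (sym e) (λ _ _ _ → refl)

-- Since κ and ω are constant on an ascent of h, swapping h there also swaps κ + ω - h.
ascent-constˡ : ∀ {κ h : Fin r → ℤ} {s t} → κ t ≤ κ s → Step κ h → h s < h t → κ s ≡ κ t
ascent-constˡ {κ = κ} {h} {s} {t} κt≤κs st lt = ℤP.≤-antisym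
  (≤-by₂ (spread st t s) (ℤP.i<j⇒suc[i]≤j lt) (arith (κ s) (κ t) (h s) (h t))) κt≤κs
  where
  arith : ∀ κs κt hs ht → κt - κs ≡ ((1ℤ + (hs - κs)) + ht) - ((ht - κt) + (1ℤ + hs))
  arith = solve-∀

ascent-constʳ : ∀ {ω h : Fin r → ℤ} {s t} → ω t ≤ ω s → Step h ω → h s < h t → ω s ≡ ω t
ascent-constʳ {ω = ω} {h} {s} {t} ωt≤ωs st lt = ℤP.≤-antisym
  (≤-by₂ (spread st s t) (ℤP.i<j⇒suc[i]≤j lt) (arith (ω s) (ω t) (h s) (h t))) ωt≤ωs
  where
  arith : ∀ ωs ωt hs ht → ωt - ωs ≡ ((1ℤ + (ωt - ht)) + ht) - ((ωs - hs) + (1ℤ + hs))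
  arith = solve-∀

-- Induction from the unsorted end `w`. Each swap that removes an ascent of `h` also swaps a descent
-- of `κ + ω - h`, so the second sequence runs in the opposite order, and the steps are merely
-- reindexed.
sorting-cell : ∀ {κ ω β w : Fin r → ℤ} → Dominant κ → Dominant ω → Step κ w → Step w ω → β ⇝ w →
  Step κ β × Step β ω × (λ i → κ i + ω i - w i) ⇝ (λ i → κ i + ω i - β i)
sorting-cell {κ = κ} {ω} dκ dω κw wω (done p) =
  Step-reindex (λ i → i , cong (_- κ i) (p i)) κw ,
  Step-reindex (λ i → i , cong (λ x → ω i - x) (p i)) wω ,
  done (λ i → cong (λ x → κ i + ω i - x) (sym (p i)))
sorting-cell {κ = κ} {ω} {β} dκ dω κw wω (step {h} (s , t , adj , lt , sw@(swapped a b c)) p) =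
  let κh , hω , chain = sorting-cell dκ dω κw wω p
      s≤t : s Fin.≤ t
      s≤t = subst (toℕ s ℕ.≤_) (sym adj) (ℕP.n≤1+n _)
      ascent : h s < h t
      ascent = subst₂ _<_ (sym a) (sym b) lt
      -- The increments from `κ` to `h` at `s` and `t` differ by at most one. The ascent of `h` uses
      -- this up, so `κ` cannot drop there; likewise `ω`.
      κst = ascent-constˡ (dκ s t s≤t) κh ascent
      ωst = ascent-constʳ (dω s t s≤t) hω ascent
      κω = cong₂ _+_ κst ωst
  in Step-reindex (swap-reindex (swapped-const {f = κ} κst) sw) κh ,
     Step-reindex (swap-reindex sw (swapped-const {f = ω} ωst)) hω ,
     ⇝-trans chain (step
       (s , t , adj ,
        subst (λ x → κ t + ω t - h t < x - h s) (sym κω)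
          (ℤP.+-monoʳ-< (κ t + ω t) (ℤP.neg-mono-< ascent)) ,
        swapped (cong₂ _-_ κω (sym b)) (cong₂ _-_ (sym κω) (sym a))
          (λ i i≢s i≢t → cong (λ x → κ i + ω i - x) (sym (c i i≢s i≢t))))
       (done λ _ → refl))

module _ (κ α ω : ZVec r) (dκ : Dominant (lookup κ)) (dω : Dominant (lookup ω))
         (κα : Step (lookup κ) (lookup α)) (αω : Step (lookup α) (lookup ω)) where
  private
    w : ZVec r
    w = (ω ⊕ κ) ⊖ α

    w-entry : ∀ i → lookup w i ≡ lookup κ i + lookup ω i - lookup α i
    w-entry i = trans (VecP.lookup-zipWith _-_ i (ω ⊕ κ) α) (cong (_- lookup α i)
      (trans (VecP.lookup-zipWith _+_ i ω κ) (ℤP.+-comm (lookup ω i) (lookup κ i))))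

    w-κ : ∀ i → lookup w i - lookup κ i ≡ lookup ω i - lookup α i
    w-κ i rewrite w-entry i = arith (lookup κ i) (lookup ω i) (lookup α i)
      where
      arith : ∀ k o a → (k + o - a) - k ≡ o - a
      arith = solve-∀

    ω-w : ∀ i → lookup ω i - lookup w i ≡ lookup α i - lookup κ i
    ω-w i rewrite w-entry i = arith (lookup κ i) (lookup ω i) (lookup α i)
      where
      arith : ∀ k o a → o - (k + o - a) ≡ a - k
      arith = solve-∀

    -- The increments trade places: from `κ` to `w` it is `ω - α`, from `w` to `ω` it is `α - κ`.
    sorted = sorting-cell dκ dω (Step-reindex (λ i → i , w-κ i) αω)
                                (Step-reindex (λ i → i , ω-w i) κα) (sort-⇝ w)

  local-rule-stepˡ : Step (lookup κ) (lookup (sort w))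
  local-rule-stepˡ = proj₁ sorted

  local-rule-stepʳ : Step (lookup (sort w)) (lookup ω)
  local-rule-stepʳ = proj₁ (proj₂ sorted)

  local-rule-cell : Cell (lookup κ) (lookup α) (lookup (sort w)) (lookup ω)
  local-rule-cell = cell
    (⇝-respˡ (λ i → trans (cong (λ x → lookup κ i + lookup ω i - x) (w-entry i))
                          (arith (lookup κ i + lookup ω i) (lookup α i)))
             (proj₂ (proj₂ sorted)))
    (⇝-respʳ w-entry (sort-⇝ w))
    where
    arith : ∀ x a → x - (x - a) ≡ a
    arith = solve-∀

-- Rows of the promotion-evacuation diagram.

record RectangularRow (n : ℕ) (c : ℤ) (R : ℕ → ZVec r) : Set where
  field
    starts : ∀ i → lookup (R 0) i ≡ 0ℤ
    ends   : ∀ i → lookup (R n) i ≡ c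
    dom    : ∀ m → m ℕ.≤ n → Dominant (lookup (R m))
    steps  : ∀ m → m ℕ.< n → Step (lookup (R m)) (lookup (R (suc m)))
open RectangularRow

constant-dominant : ∀ {f : Fin r → ℤ} {c} → (∀ i → f i ≡ c) → Dominant f
constant-dominant e i j _ = ℤP.≤-reflexive (trans (e j) (sym (e i)))

module _ {r n : ℕ} (T : Seq r n) where

  PE-last : ∀ i {m} → suc m ≡ n → PE T (suc i) (suc m) ≡ at T n
  PE-last i {m} e rewrite dec-true (suc m ℕ.≟ n) e = refl

  PE-inner : ∀ i {m} → suc m ≢ n →
             PE T (suc i) (suc m) ≡ sort ((PE T i (suc (suc m)) ⊕ PE T (suc i) m) ⊖ PE T i (suc m))
  PE-inner i {m} ne rewrite dec-false (suc m ℕ.≟ n) ne = refl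

  module _ {c : ℤ} (at0 : ∀ j → lookup (at T 0) j ≡ 0ℤ) (atn : ∀ j → lookup (at T n) j ≡ c)
           {i : ℕ} (row : RectangularRow n c (PE T i)) where

    -- Offset `m` in row `suc i` and offset `suc m` in row `i` are the same column, so this is the
    -- vertical step. It is proved along the row since the local rule at the next cell takes it as
    -- input.
    descent : ∀ m → m ℕ.< n → Dominant (lookup (PE T (suc i) m)) ×
                              Step (lookup (PE T (suc i) m)) (lookup (PE T i (suc m)))
    descent zero 0<n = constant-dominant at0 ,
      Step-reindex (λ j → j , cong (λ x → lookup (PE T i 1) j - x) (trans (at0 j) (sym (starts row j))))
                   (steps row 0 0<n)
    descent (suc m) m<n rewrite PE-inner i (ℕP.<⇒≢ m<n) =
      let dκ , κα = descent m (ℕP.<⇒≤ m<n)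
      in sort-dominant ((PE T i (suc (suc m)) ⊕ PE T (suc i) m) ⊖ PE T i (suc m)) ,
         local-rule-stepʳ (PE T (suc i) m) (PE T i (suc m)) (PE T i (suc (suc m)))
           dκ (dom row (suc (suc m)) m<n) κα (steps row (suc m) m<n)

    inner-step : ∀ m → suc m ℕ.< n → Step (lookup (PE T (suc i) m)) (lookup (PE T (suc i) (suc m)))
    inner-step m m<n rewrite PE-inner i (ℕP.<⇒≢ m<n) =
      let dκ , κα = descent m (ℕP.<⇒≤ m<n)
      in local-rule-stepˡ (PE T (suc i) m) (PE T i (suc m)) (PE T i (suc (suc m)))
           dκ (dom row (suc (suc m)) m<n) κα (steps row (suc m) m<n)

    PE-cell : ∀ m → suc m ℕ.< n → Cell (lookup (PE T (suc i) m)) (lookup (PE T i (suc m)))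
                                       (lookup (PE T (suc i) (suc m))) (lookup (PE T i (suc (suc m))))
    PE-cell m m<n rewrite PE-inner i (ℕP.<⇒≢ m<n) =
      let dκ , κα = descent m (ℕP.<⇒≤ m<n)
      in local-rule-cell (PE T (suc i) m) (PE T i (suc m)) (PE T i (suc (suc m)))
           dκ (dom row (suc (suc m)) m<n) κα (steps row (suc m) m<n)

    PE-end : ∀ m → m ≡ n → ∀ j → lookup (PE T (suc i) m) j ≡ c
    PE-end zero    refl j = atn j
    PE-end (suc m) e    j = trans (cong (λ v → lookup v j) (PE-last i e)) (atn j)

    next-row : RectangularRow n c (PE T (suc i))
    next-row = record
      { starts = at0
      ; ends   = PE-end n refl
      ; dom    = λ m m≤n → dominant m m≤n
      ; steps  = λ m m<n → step′ m m<n }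
      where
      dominant : ∀ m → m ℕ.≤ n → Dominant (lookup (PE T (suc i) m))
      dominant m m≤n with m ℕ.≟ n
      ... | yes e = constant-dominant (PE-end m e)
      ... | no ne = proj₁ (descent m (ℕP.≤∧≢⇒< m≤n ne))
      step′ : ∀ m → m ℕ.< n → Step (lookup (PE T (suc i) m)) (lookup (PE T (suc i) (suc m)))
      step′ m m<n with suc m ℕ.≟ n
      ... | no ne = inner-step m (ℕP.≤∧≢⇒< m<n ne)
      -- Both rows end at the constant `c`, so the last horizontal step has the differences of the
      -- vertical one.
      ... | yes refl = Step-reindex
        (λ j → j , cong (_- lookup (PE T (suc i) m) j) (trans (PE-end n refl j) (sym (ends row j))))
        (proj₂ (descent m m<n))

  -- Rectangles inside the diagram.

  module _ {c : ℤ} (row₀ : RectangularRow n c (PE T 0)) where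

    PE-row : ∀ i → RectangularRow n c (PE T i)
    PE-row zero    = row₀
    PE-row (suc i) = next-row (starts row₀) (ends row₀) (PE-row i)

    segment : ℕ → ℕ → Row r
    segment i e q = lookup (PE T i (e ℕ.+ q))

    segment-dominant : ∀ i e {d} → e ℕ.+ d ℕ.≤ n → ∀ q → q ℕ.≤ d → Dominant (segment i e q)
    segment-dominant i e ≤n q q≤d = dom (PE-row i) _ (ℕP.≤-trans (ℕP.+-monoʳ-≤ e q≤d) ≤n)

    segment-promotes : ∀ i e {d} → suc e ℕ.+ d ℕ.≤ n → Promotes (segment i (suc e)) (segment (suc i) e) d
    segment-promotes i e {d} ≤n = record
      { domˡ  = segment-dominant i (suc e) ≤n
      ; domʳ  = segment-dominant (suc i) e (ℕP.<⇒≤ ≤n)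
      ; cells = cells′ }
      where
      cells′ : ∀ q → q ℕ.< d → Cell (segment (suc i) e q) (segment i (suc e) q)
                                    (segment (suc i) e (suc q)) (segment i (suc e) (suc q))
      cells′ q q<d rewrite ℕP.+-suc e q = PE-cell (starts row₀) (ends row₀) (PE-row i) (e ℕ.+ q)
        (ℕP.≤-trans (ℕP.≤-reflexive (cong suc (sym (ℕP.+-suc e q)))) (ℕP.≤-trans (ℕP.+-monoʳ-≤ (suc e) q<d) ≤n))

    -- Going down one row lowers the offset of a fixed column by one, so `f` becomes `e` after `a`
    -- rows. `e` stays general because intermediate rows start at positive offsets.
    segment-transports : ∀ i a e {f d} → a ℕ.+ e ≡ f → f ℕ.+ d ≡ n →
      Transports (segment i f) (segment (a ℕ.+ i) e) d ×
      Transports (rotate d (segment (a ℕ.+ i) e)) (rotate d (segment i f)) d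
    segment-transports i zero    e refl f+d = transports-refl , transports-refl
    segment-transports i (suc a) e {f} {d} eq f+d =
      let down , up = segment-transports i a (suc e) (trans (ℕP.+-suc a e) eq) f+d
          pr = segment-promotes (a ℕ.+ i) e (ℕP.≤-trans (ℕP.+-monoˡ-≤ d e<f) (ℕP.≤-reflexive f+d))
      in transports-trans down (promotes⇒transports pr) ,
         transports-trans (promotes⇒transports (promotes-rotate pr)) up
      where
      e<f : suc e ℕ.≤ f
      e<f = subst (suc e ℕ.≤_) eq (ℕ.s≤s (ℕP.m≤n+m e a))

    -- The rectangle with rows `i` to `a + i` and columns `a + i` to `n + i`: its lower left corner
    -- starts a row, its upper right corner ends one.
    PE-complement : ∀ i a d → a ℕ.+ d ≡ n → ∀ j →
                    lookup (PE T (a ℕ.+ i) d) j ≡ c - lookup (PE T i a) (opposite j)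
    PE-complement i a d a+d j =
      let down , up = segment-transports i a 0 (ℕP.+-identityʳ a) a+d
      in trans
        (rectangle-complement down up
          (segment-dominant i a (ℕP.≤-reflexive a+d))
          (segment-dominant (a ℕ.+ i) 0 (ℕP.≤-trans (ℕP.m≤n+m d a) (ℕP.≤-reflexive a+d)))
          (λ j → subst (λ m → lookup (PE T i m) j ≡ c) (sym a+d) (ends (PE-row i) j))
          (starts (PE-row (a ℕ.+ i))) j)
        (cong (λ m → c - lookup (PE T i m) (opposite j)) (ℕP.+-identityʳ a))

-- Promotion as a shift of the diagram.

at-≡ : ∀ {r n} (T : Seq r n) {m} (m≤n : m ℕ.≤ n) → at T m ≡ T (Fin.fromℕ< (ℕ.s≤s m≤n))
at-≡ {n = n} T {m} m≤n with m ℕ.<? suc n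
... | yes p = refl
... | no ¬p = contradiction (ℕ.s≤s m≤n) ¬p

at-toℕ : ∀ {r n} (T : Seq r n) k → at T (toℕ k) ≡ T k
at-toℕ T k = trans (at-≡ T (ℕP.≤-pred (FinP.toℕ<n k))) (cong T (FinP.fromℕ<-toℕ k _))

at-promotion : ∀ {r n} (T : Seq r n) {m} → m ℕ.≤ n → at (promotion T) m ≡ PE T 1 m
at-promotion T m≤n = trans (at-≡ (promotion T) m≤n) (cong (PE T 1) (FinP.toℕ-fromℕ< (ℕ.s≤s m≤n)))

PE-promotion-step : ∀ {r n} (T : Seq r n) i m → suc m ℕ.≤ n →
  (suc (suc m) ℕ.≤ n → PE (promotion T) i (suc (suc m)) ≡ PE T (suc i) (suc (suc m))) →
  PE (promotion T) (suc i) m ≡ PE T (suc (suc i)) m →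
  PE (promotion T) i (suc m) ≡ PE T (suc i) (suc m) →
  PE (promotion T) (suc i) (suc m) ≡ PE T (suc (suc i)) (suc m)
PE-promotion-step {n = n} T i m m≤n ω κ α with suc m ℕ.≟ n
... | yes refl = trans (PE-last (promotion T) i refl)
  (trans (at-promotion T ℕP.≤-refl) (trans (PE-last T 0 refl) (sym (PE-last T (suc i) refl))))
... | no ne = trans (PE-inner (promotion T) i ne)
  (trans (cong sort (cong₂ _⊖_ (cong₂ _⊕_ (ω (ℕP.≤∧≢⇒< m≤n ne)) κ) α))
         (sym (PE-inner T (suc i) ne)))

-- The local rule sees only neighbouring entries and boundary values, and promotion keeps the
-- latter; so the diagram just loses its first row.
PE-promotion : ∀ {r n} (T : Seq r n) i m → m ℕ.≤ n → PE (promotion T) i m ≡ PE T (suc i) m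
PE-promotion T zero    m       m≤n = at-promotion T m≤n
PE-promotion T (suc i) zero    m≤n = at-promotion T ℕ.z≤n
PE-promotion T (suc i) (suc m) m≤n = PE-promotion-step T i m m≤n
  (PE-promotion T i (suc (suc m)))
  (PE-promotion T (suc i) m (ℕP.<⇒≤ m≤n))
  (PE-promotion T i (suc m) m≤n)

PE-promotionIter : ∀ {r n} (T : Seq r n) k i m → m ℕ.≤ n → PE (promotionIter k T) i m ≡ PE T (k ℕ.+ i) m
PE-promotionIter T zero    i m m≤n = refl
PE-promotionIter T (suc k) i m m≤n =
  trans (PE-promotion (promotionIter k T) i m m≤n)
  (trans (PE-promotionIter T k (suc i) m m≤n) (cong (λ x → PE T x m) (ℕP.+-suc k i)))

-- From tableaux to rectangular rows.

letter-spread : ∀ {S : Letter r} → IsLetter S → ∀ i j → lookup (eVec S) i ≤ 1ℤ + lookup (eVec S) j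
letter-spread {S = p , q} l i j
  rewrite VecP.lookup∘tabulate (λ i → b2z (lookup p i) - b2z (lookup q i)) i
        | VecP.lookup∘tabulate (λ i → b2z (lookup p i) - b2z (lookup q i)) j
  with l
... | inj₁ refl rewrite VecP.lookup-replicate i false | VecP.lookup-replicate j false =
  bound (lookup q i) (lookup q j)
  where
  bound : ∀ x y → 0ℤ - b2z x ≤ 1ℤ + (0ℤ - b2z y)
  bound false false = ℤ.+≤+ ℕ.z≤n
  bound false true  = ℤ.+≤+ ℕ.z≤n
  bound true  false = ℤ.-≤+
  bound true  true  = ℤ.-≤+
... | inj₂ refl rewrite VecP.lookup-replicate i false | VecP.lookup-replicate j false =
  bound (lookup p i) (lookup p j)
  where
  bound : ∀ x y → b2z x - 0ℤ ≤ 1ℤ + (b2z y - 0ℤ)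
  bound false false = ℤ.+≤+ ℕ.z≤n
  bound false true  = ℤ.+≤+ ℕ.z≤n
  bound true  false = ℤP.≤-refl
  bound true  true  = ℤ.+≤+ (ℕ.s≤s ℕ.z≤n)

tableau-row : ∀ {r n} (T : Seq r n) → IsFluctuatingTableau T → IsNonSkew T → ∀ {c} →
              (∀ i → lookup (T (fromℕ n)) i ≡ c) → RectangularRow n c (PE T 0)
tableau-row {n = n} T (partition , letters) T0 Tn = record
  { starts = λ i → trans (cong (λ v → lookup v i) (trans (at-toℕ T Fin.zero) T0)) (VecP.lookup-replicate i 0ℤ)
  ; ends   = λ i → trans (cong (λ v → lookup v i) (trans (cong (at T) (sym (FinP.toℕ-fromℕ n))) (at-toℕ T (fromℕ n)))) (Tn i)
  ; dom    = λ m m≤n → subst (Dominant ∘ lookup) (sym (at-≡ T m≤n)) (partition _)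
  ; steps  = λ m m<n → subst₂ (λ u v → Step (lookup u) (lookup v)) (source m<n) (target m<n) (letter-step (Fin.fromℕ< m<n)) }
  where
  letter-step : ∀ k → Step (lookup (T (inject₁ k))) (lookup (T (Fin.suc k)))
  letter-step k with letters k
  ... | S , isLetter , eq rewrite eq = mkStep λ i j →
    subst₂ (λ x y → x ≤ 1ℤ + y) (sym (difference i)) (sym (difference j)) (letter-spread isLetter i j)
    where
    cancel : ∀ x y → (x + y) - x ≡ y
    cancel = solve-∀
    difference : ∀ i → lookup (T (inject₁ k) ⊕ eVec S) i - lookup (T (inject₁ k)) i ≡ lookup (eVec S) i
    difference i rewrite VecP.lookup-zipWith _+_ i (T (inject₁ k)) (eVec S) =
      cancel (lookup (T (inject₁ k)) i) (lookup (eVec S) i)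

  source : ∀ {m} (m<n : m ℕ.< n) → T (inject₁ (Fin.fromℕ< m<n)) ≡ at T m
  source m<n = trans (sym (at-toℕ T _))
    (cong (at T) (trans (FinP.toℕ-inject₁ (Fin.fromℕ< m<n)) (FinP.toℕ-fromℕ< m<n)))

  target : ∀ {m} (m<n : m ℕ.< n) → T (Fin.suc (Fin.fromℕ< m<n)) ≡ at T (suc m)
  target m<n = trans (sym (at-toℕ T _)) (cong (at T ∘ suc) (FinP.toℕ-fromℕ< m<n))

common-value : ∀ {r} (v : ZVec r) → (∀ i j → lookup v i ≡ lookup v j) → ∃ λ c → ∀ i → lookup v i ≡ c
-- Without rows no entry fixes the constant; 0 is an arbitrary choice.
common-value []      _ = 0ℤ , λ ()
common-value (x ∷ v) e = x , λ i → e i Fin.zero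

-- The order of promotion and the word of the evacuation.

lookup-ext : ∀ {A : Set} {u v : Vec A r} → lookup u ≗ lookup v → u ≡ v
lookup-ext {u = u} {v} e =
  trans (sym (VecP.tabulate∘lookup u)) (trans (VecP.tabulate-cong e) (VecP.tabulate∘lookup v))

opposite-inject₁ : ∀ {n} (k : Fin n) → opposite (inject₁ k) ≡ Fin.suc (opposite k)
opposite-inject₁ Fin.zero    = refl
opposite-inject₁ (Fin.suc k) = cong inject₁ (opposite-inject₁ k)

letterOf-reverse : ∀ {u v : ZVec r} → (∀ i → lookup u i ≡ lookup v (opposite i)) → letterOf u ≡ εL (letterOf v)
letterOf-reverse {u = u} {v} e = cong₂ _,_ (indicator 1ℤ) (indicator -1ℤ)
  where
  indicator : ∀ x → tabulate (λ i → does (lookup u i ℤ.≟ x)) ≡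
                    tabulate (lookup (tabulate (λ i → does (lookup v i ℤ.≟ x))) ∘ opposite)
  indicator x = VecP.tabulate-cong λ i →
    trans (cong (λ y → does (y ℤ.≟ x)) (e i))
          (sym (VecP.lookup∘tabulate (λ i → does (lookup v i ℤ.≟ x)) (opposite i)))

theorem6p5 : ∀ (r n : ℕ) (T : Seq r n) → IsFluctuatingTableau T → IsRectangular T →
    (∀ k → promotionIter n T k ≡ T k) × (∀ k → latticeWord (evacuation T) k ≡ εW (latticeWord T) k)
theorem6p5 r n T tableau (nonSkew , rectangular) = order-n , evacuation-word
  where
  c : ℤ
  c = proj₁ (common-value (T (fromℕ n)) rectangular)

  row : RectangularRow n c (PE T 0)
  row = tableau-row T tableau nonSkew (proj₂ (common-value (T (fromℕ n)) rectangular))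

  double-complement : ∀ c x → c - (c - x) ≡ x
  double-complement = solve-∀

  order-n : ∀ k → promotionIter n T k ≡ T k
  order-n k =
    trans (sym (at-toℕ (promotionIter n T) k))
    (trans (PE-promotionIter T n 0 (toℕ k) k≤n)
    (trans (lookup-ext periodic) (at-toℕ T k)))
    where
    k≤n : toℕ k ℕ.≤ n
    k≤n = ℕP.≤-pred (FinP.toℕ<n k)
    l = n ℕ.∸ toℕ k
    -- Row `n` at offset `k` is complementary to row `k` at offset `n - k`, which is complementary
    -- to row 0 at offset `k`.
    periodic : lookup (PE T (n ℕ.+ 0) (toℕ k)) ≗ lookup (at T (toℕ k))
    periodic j = begin
      lookup (PE T (n ℕ.+ 0) (toℕ k)) j
        ≡⟨ cong (λ i → lookup (PE T i (toℕ k)) j)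
             (trans (cong (ℕ._+ 0) (sym (ℕP.m∸n+n≡m k≤n))) (ℕP.+-assoc l (toℕ k) 0)) ⟩
      lookup (PE T (l ℕ.+ (toℕ k ℕ.+ 0)) (toℕ k)) j
        ≡⟨ PE-complement T row (toℕ k ℕ.+ 0) l (toℕ k) (ℕP.m∸n+n≡m k≤n) j ⟩
      c - lookup (PE T (toℕ k ℕ.+ 0) l) (opposite j)
        ≡⟨ cong (λ x → c - x) (PE-complement T row 0 (toℕ k) l (ℕP.m+[n∸m]≡n k≤n) (opposite j)) ⟩
      c - (c - lookup (at T (toℕ k)) (opposite (opposite j)))
        ≡⟨ double-complement c _ ⟩
      lookup (at T (toℕ k)) (opposite (opposite j))
        ≡⟨ cong (lookup (at T (toℕ k))) (FinP.opposite-involutive j) ⟩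
      lookup (at T (toℕ k)) j ∎
      where open ≡-Reasoning

  -- Evacuation reads column `n` from the bottom up: its `k`-th vector lies in row `n - k`, and is
  -- complementary to row 0 at offset `n - k`.
  evacuation-entry : ∀ k j → lookup (evacuation T k) j ≡ c - lookup (T (opposite k)) (opposite j)
  evacuation-entry k j = begin
    lookup (PE T l (toℕ k)) j
      ≡⟨ cong (λ i → lookup (PE T i (toℕ k)) j) (sym (ℕP.+-identityʳ l)) ⟩
    lookup (PE T (l ℕ.+ 0) (toℕ k)) j
      ≡⟨ PE-complement T row 0 l (toℕ k) (ℕP.m∸n+n≡m (ℕP.≤-pred (FinP.toℕ<n k))) j ⟩
    c - lookup (at T l) (opposite j)
      ≡⟨ cong (λ v → c - lookup v (opposite j))
           (trans (cong (at T) (sym (FinP.opposite-prop k))) (at-toℕ T (opposite k))) ⟩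
    c - lookup (T (opposite k)) (opposite j) ∎
    where
    open ≡-Reasoning
    l = n ℕ.∸ toℕ k

  -- Complementing negates each step and reading backwards negates it again, so signs are kept and
  -- only the row indices are reversed, as in `εL`.
  evacuation-word : ∀ k → latticeWord (evacuation T) k ≡ εW (latticeWord T) k
  evacuation-word k = letterOf-reverse
    {u = evacuation T (Fin.suc k) ⊖ evacuation T (inject₁ k)}
    {v = T (Fin.suc (opposite k)) ⊖ T (inject₁ (opposite k))} λ i →
    begin
    lookup (evacuation T (Fin.suc k) ⊖ evacuation T (inject₁ k)) i
      ≡⟨ VecP.lookup-zipWith _-_ i (evacuation T (Fin.suc k)) _ ⟩
    lookup (evacuation T (Fin.suc k)) i - lookup (evacuation T (inject₁ k)) i
      ≡⟨ cong₂ _-_ (evacuation-entry (Fin.suc k) i) (trans (evacuation-entry (inject₁ k) i)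
           (cong (λ k → c - lookup (T k) (opposite i)) (opposite-inject₁ k))) ⟩
    (c - lookup (T (inject₁ (opposite k))) (opposite i)) - (c - lookup (T (Fin.suc (opposite k))) (opposite i))
      ≡⟨ difference c _ (lookup (T (Fin.suc (opposite k))) (opposite i)) ⟩
    lookup (T (Fin.suc (opposite k))) (opposite i) - lookup (T (inject₁ (opposite k))) (opposite i)
      ≡⟨ VecP.lookup-zipWith _-_ (opposite i) (T (Fin.suc (opposite k))) _ ⟨
    lookup (T (Fin.suc (opposite k)) ⊖ T (inject₁ (opposite k))) (opposite i) ∎
    where
    open ≡-Reasoning
    difference : ∀ c x y → (c - x) - (c - y) ≡ y - x
    difference = solve-∀
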